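{- In the $1:1$ Walker-Breaker game played on the hypercube $Q_n$, under optimal play by both players, the number of vertices visited by Walker is at least $2^{n-2}$ and at most $2^{n-1}$.
   Context: $Q_n$ is the graph with vertex set $\{0,1\}^n$ in which two strings are adjacent iff they differ in exactly one coordinate. The $1:1$ Walker-Breaker game on a graph $G$: two players, Walker and Breaker, alternate turns. Walker is positioned at a vertex of $G$ (her initial vertex counts as visited). On her turn she moves from her current vertex $v$ along any edge $e=vw$ of $G$ that has not been acquired by Breaker (revisiting vertices and reusing her own edges is allowed); if she has not already acquired $e$ she acquires it, and $w$ becomes visited. On his turn Breaker acquires one edge of $G$ not already acquired by Walker. The game ends when there is no path from Walker's current position to an unvisited vertex along edges not acquired by Breaker. Walker wants to maximize, and Breaker to minimize, the number of vertices Walker visits.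
   Formalization: The claim is stated for n ≥ 2 with Walker moving first; for n = 1 she crosses the only edge and visits 2 > 2^{n-1} = 1 vertices, and for n = 0 she has visited 1 > 1/2, so the upper bound fails there. -}

module Defs where

open import Data.Bool using (Bool; false; not)
import Data.Bool.Properties as BoolP
open import Data.Nat using (ℕ; _≤_)
open import Data.Fin using (Fin)
open import Data.Vec using (Vec; replicate; updateAt)
import Data.Vec.Properties as VecP
open import Data.List using (List; []; _∷_; length; deduplicate)
open import Data.List.Relation.Unary.Any using (Any)
open import Data.List.Membership.Propositional using (_∉_)
open import Data.Product using (_×_; _,_; ∃)
open import Data.Sum using (_⊎_)
open import Relation.Binary.PropositionalEquality using (_≡_)
open import Relation.Nullary using (¬_)

Vertex : ℕ → Set
Vertex n = Vec Bool n

flipAt : ∀ {n} → Fin n → Vertex n → Vertex n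
flipAt i v = updateAt v i not

-- An edge of Q_n is given by an endpoint v and a direction i;
-- it joins v and flipAt i v.  (v , i) and (flipAt i v , i) denote the same edge.
Edge : ℕ → Set
Edge n = Vertex n × Fin n

SameEdge : ∀ {n} → Edge n → Edge n → Set
SameEdge (v , i) (w , j) = i ≡ j × (v ≡ w ⊎ flipAt i v ≡ w)

_∈E_ : ∀ {n} → Edge n → List (Edge n) → Set
e ∈E L = Any (SameEdge e) L

_∉E_ : ∀ {n} → Edge n → List (Edge n) → Set
e ∉E L = ¬ (e ∈E L)

record State (n : ℕ) : Set where
  constructor mkState
  field
    pos     : Vertex n
    visited : List (Vertex n)
    walkerE : List (Edge n)
    breakerE : List (Edge n)
open State public

initial : ∀ {n} → Vertex n → State n
initial v = mkState v (v ∷ []) [] []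

count : ∀ {n} → State n → ℕ
count s = length (deduplicate (VecP.≡-dec BoolP._≟_) (visited s))

data Reach {n : ℕ} (B : List (Edge n)) : Vertex n → Vertex n → Set where
  here : ∀ {v} → Reach B v v
  step : ∀ {v w} (i : Fin n) → (v , i) ∉E B → Reach B (flipAt i v) w → Reach B v w

Over : ∀ {n} → State n → Set
Over s = ¬ ∃ (λ w → Reach (breakerE s) (pos s) w × w ∉ visited s)

walkerMove : ∀ {n} → State n → Fin n → State n
walkerMove (mkState p vis W B) i =
  mkState (flipAt i p) (flipAt i p ∷ vis) ((p , i) ∷ W) B

WalkerLegal : ∀ {n} → State n → Fin n → Set
WalkerLegal s i = (pos s , i) ∉E breakerE s

breakerMove : ∀ {n} → State n → Edge n → State n
breakerMove (mkState p vis W B) e = mkState p vis W (e ∷ B)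

BreakerLegal : ∀ {n} → State n → Edge n → Set
BreakerLegal s e = e ∉E walkerE s × e ∉E breakerE s

-- Walker can force at least k visited vertices (finite play),
-- from a state with Walker to move (W) / Breaker to move (B).
mutual
  data WalkerForcesW {n : ℕ} (k : ℕ) : State n → Set where
    reachedW : ∀ {s} → k ≤ count s → WalkerForcesW k s
    moveW    : ∀ {s} → ¬ Over s → (i : Fin n) → WalkerLegal s i →
               WalkerForcesB k (walkerMove s i) → WalkerForcesW k s

  data WalkerForcesB {n : ℕ} (k : ℕ) : State n → Set where
    reachedB : ∀ {s} → k ≤ count s → WalkerForcesB k s
    allB     : ∀ {s} → ¬ Over s →
               ((e : Edge n) → BreakerLegal s e → WalkerForcesW k (breakerMove s e)) →
               WalkerForcesB k s

mutual
  data BreakerForcesW {n : ℕ} (k : ℕ) : State n → Set where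
    endW  : ∀ {s} → Over s → count s ≤ k → BreakerForcesW k s
    allW  : ∀ {s} → ¬ Over s →
            ((i : Fin n) → WalkerLegal s i → BreakerForcesB k (walkerMove s i)) →
            BreakerForcesW k s

  data BreakerForcesB {n : ℕ} (k : ℕ) : State n → Set where
    endB  : ∀ {s} → Over s → count s ≤ k → BreakerForcesB k s
    moveB : ∀ {s} → ¬ Over s → (e : Edge n) → BreakerLegal s e →
            BreakerForcesW k (breakerMove s e) → BreakerForcesB k s

{-# OPTIONS --safe #-}
module Submission where

-- Walker explores the cube depth-first: she moves to an unvisited vertex if she can and
-- otherwise goes back along her own edges.  Visited vertices off her current trail have
-- all their edges to unvisited vertices in Breaker's hands, so as soon as she is stuck,
-- Breaker owns the whole edge boundary of the visited set S.  A depth-first search makes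
-- at most 2 (|S| − 1) moves, hence that boundary has fewer than 2 |S| edges, and the
-- edge-isoperimetric inequality |∂S| ≥ |S| (n − log₂ |S|) gives |S| ≥ 2^(n−2).
--
-- Breaker chooses a direction d different from that of Walker's first step and always
-- takes the edge in direction d at Walker's position.  She never crosses in direction d
-- and so stays in one half of the cube.

open import Defs
open import Data.Bool using (Bool; true; false; not; if_then_else_)
import Data.Bool.Properties as Bool
open import Data.Empty using (⊥)
open import Data.Fin using (Fin; zero; suc)
import Data.Fin.Properties as Fin
open import Data.List using (List; []; _∷_; length; _++_; map; filter; deduplicate; cartesianProduct; allFin)
open import Data.List.Properties using (filter-notAll)
open import Data.List.Membership.Propositional using (_∈_; _∉_; lose; find)
open import Data.List.Membership.Propositional.Properties
open import Data.List.Relation.Unary.All.Properties using (All¬⇒¬Any)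
open import Data.List.Relation.Unary.AllPairs using ([]; _∷_)
open import Data.List.Relation.Unary.Any as Any using (here; there; any?)
open import Data.List.Relation.Unary.Unique.Propositional using (Unique)
import Data.List.Relation.Unary.Unique.DecPropositional.Properties as Unique
open import Data.Nat
open import Data.Nat.Properties
open import Data.Nat.Tactic.RingSolver using (solve-∀)
open import Data.Product using (_×_; _,_; ∃; ∃₂; map₂; proj₁; proj₂)
import Data.Product.Properties as Product
open import Data.Sum as Sum using (_⊎_; inj₁; inj₂)
open import Data.Vec as Vec using ([]; _∷_; lookup)
import Data.Vec.Properties as Vec
open import Function using (_∘_)
open import Level using (0ℓ)
open import Relation.Binary.PropositionalEquality
open import Relation.Nullary
open import Relation.Nullary.Decidable using (_×-dec_; _⊎-dec_; ¬?; decidable-stable; map′)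
open import Relation.Unary using (Pred; Decidable)

private variable
  n : ℕ
  P Q : Pred (Vertex n) 0ℓ

-- Cardinality of decidable sets of vertices

-- Recursion on the dimension makes the split into two half-cubes hold by definition, which is what
-- the isoperimetric induction needs.
size : {P : Pred (Vertex n) 0ℓ} → Decidable P → ℕ
size {zero}  P? = if does (P? []) then 1 else 0
size {suc n} P? = size (P? ∘ (false ∷_)) + size (P? ∘ (true ∷_))

tailsWith : Bool → List (Vertex (suc n)) → List (Vertex n)
tailsWith b []            = []
tailsWith b ((c ∷ v) ∷ L) with b Bool.≟ c
... | yes _ = v ∷ tailsWith b L
... | no  _ = tailsWith b L

length-tailsWith : (L : List (Vertex (suc n))) →
  length (tailsWith false L) + length (tailsWith true L) ≡ length L
length-tailsWith []                = refl
length-tailsWith ((false ∷ _) ∷ L) = cong suc (length-tailsWith L)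
length-tailsWith ((true  ∷ _) ∷ L) = trans (+-suc _ _) (cong suc (length-tailsWith L))

∈-tailsWith : ∀ {b} {v : Vertex n} {L} → (b ∷ v) ∈ L → v ∈ tailsWith b L
∈-tailsWith {b = b} {L = (c ∷ _) ∷ _} (here refl) with b Bool.≟ b
... | yes _  = here refl
... | no b≢b = contradiction refl b≢b
∈-tailsWith {b = b} {L = (c ∷ _) ∷ _} (there v∈L) with b Bool.≟ c
... | yes _ = there (∈-tailsWith v∈L)
... | no _  = ∈-tailsWith v∈L

swap-middle : ∀ a b c d → (a + b) + (c + d) ≡ (a + c) + (b + d)
swap-middle = solve-∀

-- Serves three ends: monotonicity (`L` empty), the comparison of two slices of a set through the
-- crossing edges, and the bound by `count` (`Q` empty).
size-cover : (P? : Decidable P) (Q? : Decidable Q) (L : List (Vertex n)) →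
  (∀ v → P v → Q v ⊎ v ∈ L) → size P? ≤ size Q? + length L
size-cover {zero} P? Q? L cover with P? [] | Q? []
... | no _   | _     = z≤n
... | yes _  | yes _ = s≤s z≤n
... | yes p  | no ¬q with cover [] p
...   | inj₁ q = contradiction q ¬q
...   | inj₂ (here _)  = s≤s z≤n
...   | inj₂ (there _) = s≤s z≤n
size-cover {suc n} P? Q? L cover = begin
  size (P? ∘ (false ∷_)) + size (P? ∘ (true ∷_))
    ≤⟨ +-mono-≤ (half false) (half true) ⟩
  (size (Q? ∘ (false ∷_)) + length (tailsWith false L)) +
  (size (Q? ∘ (true ∷_)) + length (tailsWith true L))
    ≡⟨ swap-middle (size (Q? ∘ (false ∷_))) _ _ _ ⟩
  size Q? + (length (tailsWith false L) + length (tailsWith true L))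
    ≡⟨ cong (size Q? +_) (length-tailsWith L) ⟩
  size Q? + length L ∎
  where
  open ≤-Reasoning
  half : ∀ b → size (P? ∘ (b ∷_)) ≤ size (Q? ∘ (b ∷_)) + length (tailsWith b L)
  half b = size-cover (P? ∘ (b ∷_)) (Q? ∘ (b ∷_)) (tailsWith b L)
    (λ v → Sum.map₂ ∈-tailsWith ∘ cover (b ∷ v))

size-mono : (P? : Decidable P) (Q? : Decidable Q) →
  (∀ v → P v → Q v) → size P? ≤ size Q?
size-mono P? Q? P⊆Q =
  subst (size P? ≤_) (+-identityʳ _) (size-cover P? Q? [] (λ v → inj₁ ∘ P⊆Q v))

size-mono-< : (P? : Decidable P) (Q? : Decidable Q) → (∀ v → P v → Q v) →
  ∀ w → Q w → ¬ P w → size P? < size Q?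
size-mono-< {zero} P? Q? P⊆Q [] q ¬p with P? [] | Q? []
... | yes p | _     = contradiction p ¬p
... | no _  | yes _ = s≤s z≤n
... | no _  | no ¬q = contradiction q ¬q
size-mono-< {suc n} P? Q? P⊆Q (false ∷ w) q ¬p = +-mono-<-≤
  (size-mono-< (P? ∘ (false ∷_)) (Q? ∘ (false ∷_)) (λ v → P⊆Q _) w q ¬p)
  (size-mono (P? ∘ (true ∷_)) (Q? ∘ (true ∷_)) (λ v → P⊆Q _))
size-mono-< {suc n} P? Q? P⊆Q (true ∷ w) q ¬p = +-mono-≤-<
  (size-mono (P? ∘ (false ∷_)) (Q? ∘ (false ∷_)) (λ v → P⊆Q _))
  (size-mono-< (P? ∘ (true ∷_)) (Q? ∘ (true ∷_)) (λ v → P⊆Q _) w q ¬p)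

size-∅ : (P? : Decidable P) → (∀ v → ¬ P v) → size {n} P? ≡ 0
size-∅ {zero} P? ¬P with P? []
... | yes p = contradiction p (¬P [])
... | no _  = refl
size-∅ {suc n} P? ¬P =
  cong₂ _+_ (size-∅ (P? ∘ (false ∷_)) (¬P ∘ (false ∷_))) (size-∅ (P? ∘ (true ∷_)) (¬P ∘ (true ∷_)))

size≤2^n : (P? : Decidable P) → size {n} P? ≤ 2 ^ n
size≤2^n {zero} P? with P? []
... | yes _ = s≤s z≤n
... | no _  = z≤n
size≤2^n {suc n} P? = +-mono-≤ (size≤2^n (P? ∘ (false ∷_)))
  (subst (size (P? ∘ (true ∷_)) ≤_) (sym (+-identityʳ _)) (size≤2^n (P? ∘ (true ∷_))))

-- Edge-isoperimetric inequality for the cube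

layer : Bool → List (Edge (suc n)) → List (Edge n)
layer b []                      = []
layer b ((_ , zero) ∷ B)        = layer b B
layer b ((c ∷ v , suc i) ∷ B) with b Bool.≟ c
... | yes _ = (v , i) ∷ layer b B
... | no  _ = layer b B

-- The two representations of an edge in direction `zero` share their tail, so the tail alone
-- identifies the edge.
crossing : List (Edge (suc n)) → List (Vertex n)
crossing []                   = []
crossing ((_ ∷ v , zero) ∷ B) = v ∷ crossing B
crossing ((_ , suc _) ∷ B)    = crossing B

length-layers : (B : List (Edge (suc n))) →
  length (layer false B) + length (layer true B) + length (crossing B) ≡ length B
length-layers []                          = refl
length-layers ((_ ∷ _ , zero) ∷ B)        = trans (+-suc _ _) (cong suc (length-layers B))
length-layers ((false ∷ _ , suc _) ∷ B)   = cong suc (length-layers B)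
length-layers ((true  ∷ _ , suc _) ∷ B)   =
  trans (cong (_+ length (crossing B)) (+-suc (length (layer false B)) _)) (cong suc (length-layers B))

∈-layer : ∀ {b} {v : Vertex n} {i B} → (b ∷ v , suc i) ∈E B → (v , i) ∈E layer b B
∈-layer {B = (_ , zero) ∷ _}        (here (() , _))
∈-layer {B = (_ , zero) ∷ _}        (there e∈B) = ∈-layer e∈B
∈-layer {b = b} {B = (c ∷ _ , suc _) ∷ _} (there e∈B) with b Bool.≟ c
... | yes _ = there (∈-layer e∈B)
... | no _  = ∈-layer e∈B
∈-layer {b = b} {B = (c ∷ _ , suc _) ∷ _} (here (refl , same)) with b Bool.≟ c
... | yes refl = here (refl , Sum.map (cong Vec.tail) (cong Vec.tail) same)
... | no b≢c = contradiction
  (Sum.[ cong Vec.head , cong Vec.head ] same) b≢c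

∈-crossing : ∀ {b} {v : Vertex n} {B} → (b ∷ v , zero) ∈E B → v ∈ crossing B
∈-crossing {B = (_ ∷ _ , suc _) ∷ _}    (here (() , _))
∈-crossing {B = (_ ∷ _ , suc _) ∷ _}    (there e∈B) = ∈-crossing e∈B
∈-crossing {B = (_ ∷ _ , zero) ∷ _} (there e∈B) = there (∈-crossing e∈B)
∈-crossing {B = (_ ∷ _ , zero) ∷ _} (here (refl , inj₁ refl)) = here refl
∈-crossing {B = (_ ∷ _ , zero) ∷ _} (here (refl , inj₂ refl)) = here refl

-- With m = |S| and b the size of its boundary, the classical bound n m − b ≤ m log₂ m is
-- replaced by its piecewise linear version: m log₂ m at powers of two, interpolated
-- linearly, is the maximum over k of (k + 2) m − 2^(k+1).  Unlike "n m − b ≤ k m for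
-- m ≤ 2^k", this form is stable under the induction on n that splits the cube in two.
IsoBound : ℕ → ℕ → ℕ → Set
IsoBound n m b = ∃ λ k → n * m + 2 ^ suc k ≤ (2 + k) * m + b

iso-weaken : ∀ n m {b c} → b ≤ c → IsoBound n m b → IsoBound n m c
iso-weaken n m b≤c (k , h) = k , ≤-trans h (+-monoʳ-≤ ((2 + k) * m) b≤c)

-- x and y are the sizes of the two slices of S, and c the number of boundary edges between them.
iso-combine : ∀ n i j x y p q c →
  n * x + 2 ^ suc i ≤ (2 + i) * x + p → n * y + 2 ^ suc j ≤ (2 + j) * y + q →
  x ≤ y + c → j ≤ i → IsoBound (suc n) (x + y) (p + q + c)
iso-combine n i j x y p q c hx hy x≤y+c j≤i with m≤n⇒m<n∨m≡n j≤i
-- Equal exponents: the two constants add up to the next power of two, and the slope grows by one.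
... | inj₂ refl = suc i , subst₂ _≤_ (lhs n (2 ^ suc i) x y) (rhs i x y p q c)
  (+-mono-≤ (+-mono-≤ hx hy) (m≤n+m (x + y) c))
  where
  lhs : ∀ n w x y → (n * x + w) + (n * y + w) + (x + y) ≡ suc n * (x + y) + 2 * w
  lhs = solve-∀
  rhs : ∀ i x y p q c → ((2 + i) * x + p) + ((2 + i) * y + q) + (c + (x + y)) ≡ (3 + i) * (x + y) + (p + q + c)
  rhs = solve-∀
... | inj₁ j<i with m≤n⇒m<n∨m≡n j<i
-- Exponents at least two apart: the slope of the `y` bound is at most `i`, which leaves room for
-- the `2 * y` that `x ≤ y + c` costs.
...   | inj₁ j+1<i = i , subst₂ _≤_ (lhs n (2 ^ suc i) x y) (rhs i x y p q c)
  (+-mono-≤ (+-mono-≤ hx hy′) (+-monoʳ-≤ y x≤y+c))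
  where
  hy′ : n * y ≤ i * y + q
  hy′ = ≤-trans (m≤m+n (n * y) _) (≤-trans hy (+-monoˡ-≤ q (*-monoˡ-≤ y j+1<i)))
  lhs : ∀ n w x y → (n * x + w) + n * y + (y + x) ≡ suc n * (x + y) + w
  lhs = solve-∀
  rhs : ∀ i x y p q c → ((2 + i) * x + p) + (i * y + q) + (y + (y + c)) ≡ (2 + i) * (x + y) + (p + q + c)
  rhs = solve-∀
-- Exponents one apart: the constants sum to three times `2 ^ suc j`, and the size of `y` decides
-- whether to round down to two or up to four times.
...   | inj₂ refl with ≤-total y (2 ^ suc j)
...     | inj₁ y≤w = suc j , +-cancelʳ-≤ (2 ^ suc j) _ _
  (subst₂ _≤_ (lhs n (2 ^ suc j) x y) (rhs j (2 ^ suc j) x y p q c)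
    (+-mono-≤ (+-mono-≤ hx hy) (+-mono-≤ x≤y+c y≤w)))
  where
  lhs : ∀ n w x y → (n * x + 2 * w) + (n * y + w) + (x + y) ≡ suc n * (x + y) + 2 * w + w
  lhs = solve-∀
  rhs : ∀ j w x y p q c → ((3 + j) * x + p) + ((2 + j) * y + q) + ((y + c) + w) ≡
    (3 + j) * (x + y) + (p + q + c) + w
  rhs = solve-∀
...     | inj₂ w≤y = 2 + j , subst₂ _≤_ (lhs n (2 ^ suc j) x y) (rhs j x y p q c)
  (+-mono-≤ (+-mono-≤ hx hy) (+-mono-≤ w≤y (m≤n+m (x + y) c)))
  where
  lhs : ∀ n w x y → (n * x + 2 * w) + (n * y + w) + (w + (x + y)) ≡ suc n * (x + y) + 2 * (2 * w)
  lhs = solve-∀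
  rhs : ∀ j x y p q c → ((3 + j) * x + p) + ((2 + j) * y + q) + (y + (c + (x + y))) ≡
    (4 + j) * (x + y) + (p + q + c)
  rhs = solve-∀

-- When the other slice is empty, every vertex has a crossing boundary edge; these pay for the extra
-- dimension with the same `k`.
iso-one-sided : ∀ n x p c → IsoBound n x p → x ≤ c → IsoBound (suc n) x (p + c)
iso-one-sided n x p c (k , h) x≤c = k , (begin
  suc n * x + 2 ^ suc k    ≡⟨ +-assoc x (n * x) _ ⟩
  x + (n * x + 2 ^ suc k)  ≤⟨ +-mono-≤ x≤c h ⟩
  c + ((2 + k) * x + p)    ≡⟨ rearrange c ((2 + k) * x) p ⟩
  (2 + k) * x + (p + c)    ∎)
  where
  open ≤-Reasoning
  rearrange : ∀ c z p → c + (z + p) ≡ z + (p + c)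
  rearrange = solve-∀

-- The empty set is kept apart because at `m = 0` the bound would demand `b` to be at least
-- `2 ^ suc k`.
iso-step : ∀ n x y p q c → x ≡ 0 ⊎ IsoBound n x p → y ≡ 0 ⊎ IsoBound n y q →
  x ≤ y + c → y ≤ x + c → x + y ≡ 0 ⊎ IsoBound (suc n) (x + y) (p + q + c)
iso-step n x y p q c (inj₁ refl) (inj₁ refl) _ _ = inj₁ refl
iso-step n x y p q c (inj₁ refl) (inj₂ hy) _ y≤c = inj₂
  (iso-weaken (suc n) y (+-monoˡ-≤ c (m≤n+m q p)) (iso-one-sided n y q c hy y≤c))
iso-step n x y p q c (inj₂ hx) (inj₁ refl) x≤c _ rewrite +-identityʳ x = inj₂
  (iso-weaken (suc n) x (+-monoˡ-≤ c (m≤m+n p q)) (iso-one-sided n x p c hx x≤c))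
iso-step n x y p q c (inj₂ (i , hx)) (inj₂ (j , hy)) x≤y+c y≤x+c with ≤-total j i
... | inj₁ j≤i = inj₂ (iso-combine n i j x y p q c hx hy x≤y+c j≤i)
... | inj₂ i≤j = inj₂ (subst₂ (IsoBound (suc n)) (+-comm y x) (cong (_+ c) (+-comm q p))
  (iso-combine n j i y x q p c hy hx y≤x+c i≤j))

isoperimetry : (P? : Decidable P) (B : List (Edge n)) →
  (∀ v i → P v → ¬ P (flipAt i v) → (v , i) ∈E B) →
  size P? ≡ 0 ⊎ IsoBound n (size P?) (length B)
isoperimetry {zero} P? B cover with P? []
-- For a single point `k = 0` gives 2 ≤ 2 + b.
... | yes _ = inj₂ (0 , s≤s (s≤s z≤n))
... | no _  = inj₁ refl
isoperimetry {suc n} P? B cover = subst (λ b → size P? ≡ 0 ⊎ IsoBound (suc n) (size P?) b) (length-layers B)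
  (iso-step n _ _ _ _ (length (crossing B))
    (isoperimetry (P? ∘ (false ∷_)) (layer false B) λ v i p ¬p → ∈-layer (cover _ _ p ¬p))
    (isoperimetry (P? ∘ (true ∷_)) (layer true B) λ v i p ¬p → ∈-layer (cover _ _ p ¬p))
    (size-cover (P? ∘ (false ∷_)) (P? ∘ (true ∷_)) (crossing B) (across false))
    (size-cover (P? ∘ (true ∷_)) (P? ∘ (false ∷_)) (crossing B) (across true)))
  where
  across : ∀ b v → _ → _ ⊎ v ∈ crossing B
  across b v p with P? (not b ∷ v)
  ... | yes q = inj₁ q
  ... | no ¬q = inj₂ (∈-crossing (cover (b ∷ v) zero p ¬q))

1+n≤2^n : ∀ n → suc n ≤ 2 ^ n
1+n≤2^n zero    = s≤s z≤n
1+n≤2^n (suc n) = +-mono-≤ (≤-trans (s≤s z≤n) (1+n≤2^n n)) (subst (suc n ≤_) (sym (+-identityʳ _)) (1+n≤2^n n))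

-- For `k + 2 ≤ n` the coefficients of `m` already compare. Otherwise the excess slope is `1 + t`
-- with `t = k + 1 - n`, and `1 + t ≤ 2 ^ t` together with `m ≤ 2 ^ n` absorbs it into the constant.
slope-bound : ∀ n k m → m ≤ 2 ^ n → (2 + k) * m ≤ n * m + 2 ^ suc k
slope-bound n k m m≤2^n with <-≤-connex (suc k) n
... | inj₁ k+2≤n = ≤-trans (*-monoˡ-≤ m k+2≤n) (m≤m+n _ _)
... | inj₂ n≤k+1 = begin
  (2 + k) * m                   ≡⟨ cong (λ l → suc l * m) (sym n+t≡k+1) ⟩
  (1 + (n + t)) * m             ≡⟨ split n t m ⟩
  n * m + suc t * m             ≤⟨ +-monoʳ-≤ (n * m) (*-mono-≤ (1+n≤2^n t) m≤2^n) ⟩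
  n * m + 2 ^ t * 2 ^ n         ≡⟨ cong (n * m +_) (trans (*-comm (2 ^ t) _) (sym (^-distribˡ-+-* 2 n t))) ⟩
  n * m + 2 ^ (n + t)           ≡⟨ cong (λ l → n * m + 2 ^ l) n+t≡k+1 ⟩
  n * m + 2 ^ suc k             ∎
  where
  open ≤-Reasoning
  t = suc k ∸ n
  n+t≡k+1 : n + t ≡ suc k
  n+t≡k+1 = m+[n∸m]≡n n≤k+1
  split : ∀ n t m → (1 + (n + t)) * m ≡ n * m + suc t * m
  split = solve-∀

-- In dimension `2 + n`, a nonempty set of fewer than `2 ^ n` vertices has at least two boundary
-- edges per vertex, by isoperimetry and `slope-bound`.
small-boundary⇒large : (P? : Decidable P) (B : List (Edge (2 + n))) →
  (∀ v i → P v → ¬ P (flipAt i v) → (v , i) ∈E B) →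
  length B < 2 * size P? → 2 ^ n ≤ size P?
small-boundary⇒large {n = n} P? B cover b<2m with isoperimetry P? B cover
... | inj₁ m≡0 = contradiction (subst (λ m → length B < 2 * m) m≡0 b<2m) λ ()
... | inj₂ (k , h) with <-≤-connex (size P?) (2 ^ n)
...   | inj₂ large = large
...   | inj₁ small = contradiction (begin-strict
  (2 + n) * m + 2 ^ suc k        ≤⟨ h ⟩
  (2 + k) * m + length B         <⟨ +-monoʳ-< ((2 + k) * m) b<2m ⟩
  (2 + k) * m + 2 * m            ≤⟨ +-monoˡ-≤ (2 * m) (slope-bound n k m (<⇒≤ small)) ⟩
  (n * m + 2 ^ suc k) + 2 * m    ≡⟨ rearrange n m (2 ^ suc k) ⟩
  (2 + n) * m + 2 ^ suc k        ∎) (<-irrefl refl)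
  where
  open ≤-Reasoning
  m = size P?
  rearrange : ∀ n m w → (n * m + w) + 2 * m ≡ (2 + n) * m + w
  rearrange = solve-∀

-- Edge identity and the number of visited vertices

_≟ⱽ_ : (v w : Vertex n) → Dec (v ≡ w)
_≟ⱽ_ = Vec.≡-dec Bool._≟_

_∈?_ : (v : Vertex n) (L : List (Vertex n)) → Dec (v ∈ L)
v ∈? L = any? (v ≟ⱽ_) L

sameEdge? : (e f : Edge n) → Dec (SameEdge e f)
sameEdge? (v , i) (w , j) = (i Fin.≟ j) ×-dec ((v ≟ⱽ w) ⊎-dec (flipAt i v ≟ⱽ w))

_∈E?_ : (e : Edge n) (L : List (Edge n)) → Dec (e ∈E L)
e ∈E? L = any? (sameEdge? e) L

flipAt-involutive : ∀ i (v : Vertex n) → flipAt i (flipAt i v) ≡ v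
flipAt-involutive i v = trans (Vec.updateAt-updateAt i v)
  (Vec.updateAt-id-local i v (Bool.not-involutive _))

sameEdge-flip : ∀ i (v : Vertex n) → SameEdge (flipAt i v , i) (v , i)
sameEdge-flip i v = refl , inj₂ (flipAt-involutive i v)

sameEdge-sym : {e f : Edge n} → SameEdge e f → SameEdge f e
sameEdge-sym (refl , inj₁ refl) = refl , inj₁ refl
sameEdge-sym {e = v , i} (refl , inj₂ refl) = sameEdge-flip i v

sameEdge-trans : {e f g : Edge n} → SameEdge e f → SameEdge f g → SameEdge e g
sameEdge-trans (refl , inj₁ refl) f≈g = f≈g
sameEdge-trans (refl , inj₂ refl) (refl , inj₁ refl) = refl , inj₂ refl
sameEdge-trans {e = v , i} (refl , inj₂ refl) (refl , inj₂ refl) =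
  refl , inj₁ (sym (flipAt-involutive i v))

∈E-resp : {e f : Edge n} {L : List (Edge n)} → SameEdge e f → f ∈E L → e ∈E L
∈E-resp e≈f = Any.map (sameEdge-trans e≈f)

visitedSize : State n → ℕ
visitedSize s = size (_∈? visited s)

visitedSize≤count : (s : State n) → visitedSize s ≤ count s
visitedSize≤count {n} s = subst (λ z → visitedSize s ≤ z + count s)
  (size-∅ ∅? (λ _ ())) (size-cover (_∈? visited s) ∅? _ λ v v∈ → inj₂ (∈-deduplicate⁺ _≟ⱽ_ v∈))
  where
  ∅? : Decidable {A = Vertex n} (λ _ → ⊥)
  ∅? _ = no λ ()

size-∷ : (v : Vertex n) (L : List (Vertex n)) → size (_∈? L) ≤ size (_∈? (v ∷ L))
size-∷ v L = size-mono (_∈? L) (_∈? (v ∷ L)) (λ _ → there)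

size-∷-∉ : (v : Vertex n) (L : List (Vertex n)) → v ∉ L → size (_∈? L) < size (_∈? (v ∷ L))
size-∷-∉ v L v∉L = size-mono-< (_∈? L) (_∈? (v ∷ L)) (λ _ → there) v (here refl) v∉L

unique⇒length≤size : {L : List (Vertex n)} → Unique L → length L ≤ size (_∈? L)
unique⇒length≤size []                    = z≤n
unique⇒length≤size {L = v ∷ L} (v∉L ∷ L!) =
  ≤-<-trans (unique⇒length≤size L!) (size-∷-∉ v L (All¬⇒¬Any v∉L))

count≤visitedSize : (s : State n) → count s ≤ visitedSize s
count≤visitedSize s = ≤-trans (unique⇒length≤size (Unique.deduplicate-! _≟ⱽ_ (visited s)))
  (size-mono (_∈? deduplicate _≟ⱽ_ (visited s)) (_∈? visited s) λ v → ∈-deduplicate⁻ _≟ⱽ_ (visited s))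

-- Walker's depth-first search

-- The stack of the search: the vertices below the current one, most recent first, joined by
-- Walker's own edges.
data Trail (W : List (Edge n)) : Vertex n → List (Vertex n) → Set where
  root : ∀ {p} → Trail W p []
  back : ∀ {p q ps} i → q ≡ flipAt i p → (p , i) ∈E W → Trail W q ps → Trail W p (q ∷ ps)

trail-weaken : ∀ {W : List (Edge n)} {e p ps} → Trail W p ps → Trail (e ∷ W) p ps
trail-weaken root             = root
trail-weaken (back i eq e∈ t) = back i eq (there e∈) (trail-weaken t)

reach-snoc : ∀ {B : List (Edge n)} {p v} i → (v , i) ∉E B → Reach B p v → Reach B p (flipAt i v)
reach-snoc i free here          = step i free here
reach-snoc i free (step j j∉ r) = step j j∉ (reach-snoc i free r)

trail-reach : ∀ {W B : List (Edge n)} {p ps x} → (∀ e → e ∈E W → e ∉E B) →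
  Trail W p ps → x ∈ p ∷ ps → Reach B p x
trail-reach W∩B=∅ t                    (here refl) = here
trail-reach W∩B=∅ (back i refl e∈W t) (there x∈)  =
  step i (W∩B=∅ _ e∈W) (trail-reach W∩B=∅ t x∈)

-- pending is 1 while Breaker's reply to Walker's last move is outstanding, and 0 otherwise.
record Exploring (pending : ℕ) (s : State n) (ps : List (Vertex n)) : Set where
  field
    trail     : Trail (walkerE s) (pos s) ps
    exhausted : ∀ x i → x ∈ visited s → flipAt i x ∉ visited s → (x , i) ∉E breakerE s → x ∈ pos s ∷ ps
    disjoint  : ∀ e → e ∈E walkerE s → e ∉E breakerE s
    -- The first two terms count Walker's moves. With m vertices visited there are m - 1 tree edges,
    -- crossed once if on the stack and twice otherwise.
    few       : pending + length (breakerE s) + (2 + length ps) ≤ 2 * visitedSize s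
open Exploring

Escape : State n → Vertex n → Fin n → Set
Escape s x i = flipAt i x ∉ visited s × (x , i) ∉E breakerE s

escape? : (s : State n) (x : Vertex n) (i : Fin n) → Dec (Escape s x i)
escape? s x i = ¬? (flipAt i x ∈? visited s) ×-dec ¬? ((x , i) ∈E? breakerE s)

-- By `few`, Breaker owns fewer than two edges per visited vertex, too few to block the whole
-- boundary of so small a set; `exhausted` puts the gap on the stack.
escape : ∀ {t} {s : State (2 + n)} {ps} → Exploring t s ps → visitedSize s < 2 ^ n →
  ∃₂ λ x i → x ∈ pos s ∷ ps × Escape s x i
escape {t = t} {s} {ps} ex small with any? (λ x → Fin.any? (escape? s x)) (visited s)
... | yes found with (x , x∈ , i , esc) ← find found =
  x , i , exhausted ex x i x∈ (proj₁ esc) (proj₂ esc) , esc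
... | no none = contradiction (small-boundary⇒large (_∈? visited s) (breakerE s) cover b<2m) (<⇒≱ small)
  where
  cover : ∀ v i → v ∈ visited s → flipAt i v ∉ visited s → (v , i) ∈E breakerE s
  cover v i v∈ fv∉ = decidable-stable ((v , i) ∈E? breakerE s) λ e∉ → none (lose v∈ (i , fv∉ , e∉))
  b<2m : length (breakerE s) < 2 * visitedSize s
  b<2m = begin-strict
    length (breakerE s)                           ≤⟨ m≤n+m _ t ⟩
    t + length (breakerE s)                       <⟨ m<m+n _ (s≤s z≤n) ⟩
    t + length (breakerE s) + (2 + length ps)     ≤⟨ few ex ⟩
    2 * visitedSize s                             ∎
    where open ≤-Reasoning

exploring⇒¬Over : ∀ {t} {s : State (2 + n)} {ps} → Exploring t s ps → visitedSize s < 2 ^ n → ¬ Over s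
exploring⇒¬Over ex small over with escape ex small
... | x , i , x∈ , fx∉ , e∉ =
  over (flipAt i x , reach-snoc i e∉ (trail-reach (disjoint ex) (trail ex) x∈) , fx∉)

-- The move and the longer stack cost one each in `few`, paid for by the new vertex, which counts
-- twice.
push : ∀ {s : State n} {ps i} → Exploring 0 s ps → Escape s (pos s) i →
  Exploring 1 (walkerMove s i) (pos s ∷ ps)
push {s = s} {ps} {i} ex (q∉ , e∉) = record
  { trail = back i (sym (flipAt-involutive i (pos s))) (here (sameEdge-flip i (pos s))) (trail-weaken (trail ex))
  ; exhausted = λ where
      x j (here refl) _   _    → here refl
      x j (there x∈) fx∉ free → there (exhausted ex x j x∈ (fx∉ ∘ there) free)
  ; disjoint = λ where
      e (here e≈)  e∈B → e∉ (∈E-resp (sameEdge-sym e≈) e∈B)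
      e (there e∈) e∈B → disjoint ex e e∈ e∈B
  ; few = begin
      1 + length (breakerE s) + (3 + length ps)  ≡⟨ rearrange (length (breakerE s)) (length ps) ⟩
      2 + (length (breakerE s) + (2 + length ps)) ≤⟨ +-monoʳ-≤ 2 (few ex) ⟩
      2 + 2 * visitedSize s                      ≡⟨ sym (*-suc 2 (visitedSize s)) ⟩
      2 * suc (visitedSize s)                    ≤⟨ *-monoʳ-≤ 2 {suc (visitedSize s)} (size-∷-∉ _ (visited s) q∉) ⟩
      2 * visitedSize (walkerMove s i)           ∎
  }
  where
  open ≤-Reasoning
  rearrange : ∀ b r → 1 + b + (3 + r) ≡ 2 + (b + (2 + r))
  rearrange = solve-∀

-- The shorter stack pays for the move, and the vertex left behind may drop off the stack because it
-- has no escape.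
pop : ∀ {s : State n} {q ps i} → Exploring 0 s (q ∷ ps) → ¬ ∃ (Escape s (pos s)) →
  q ≡ flipAt i (pos s) → (pos s , i) ∈E walkerE s → Trail (walkerE s) q ps →
  Exploring 1 (walkerMove s i) ps
pop {s = s} {ps = ps} {i} ex stuck refl e∈W t = record
  { trail = trail-weaken t
  ; exhausted = λ where
      x j (here refl) _   _    → here refl
      x j (there x∈) fx∉ free → off-pos (exhausted ex x j x∈ (fx∉ ∘ there) free) (fx∉ ∘ there) free
  ; disjoint = λ where
      e (here e≈)  e∈B → disjoint ex _ e∈W (∈E-resp (sameEdge-sym e≈) e∈B)
      e (there e∈) e∈B → disjoint ex e e∈ e∈B
  ; few = begin
      1 + length (breakerE s) + (2 + length ps) ≡⟨ rearrange (length (breakerE s)) (length ps) ⟩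
      length (breakerE s) + (3 + length ps)     ≤⟨ few ex ⟩
      2 * visitedSize s                         ≤⟨ *-monoʳ-≤ 2 (size-∷ _ (visited s)) ⟩
      2 * visitedSize (walkerMove s i)          ∎
  }
  where
  open ≤-Reasoning
  rearrange : ∀ b r → 1 + b + (2 + r) ≡ b + (3 + r)
  rearrange = solve-∀
  off-pos : ∀ {x j qs} → x ∈ pos s ∷ qs → flipAt j x ∉ visited s → (x , j) ∉E breakerE s → x ∈ qs
  off-pos (here refl) fx∉ free = contradiction (_ , fx∉ , free) stuck
  off-pos (there x∈)  _   _    = x∈

reply : ∀ {s : State n} {ps e} → Exploring 1 s ps → BreakerLegal s e → Exploring 0 (breakerMove s e) ps
reply {s = s} {ps} {e} ex (e∉W , _) = record
  { trail     = trail ex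
  ; exhausted = λ x i x∈ fx∉ free → exhausted ex x i x∈ fx∉ (free ∘ there)
  ; disjoint  = λ where
      f f∈W (here f≈e)  → e∉W (∈E-resp (sameEdge-sym f≈e) f∈W)
      f f∈W (there f∈B) → disjoint ex f f∈W f∈B
  -- The pending unit becomes Breaker's new edge, so both sums agree by definition.
  ; few = few ex
  }

-- f bounds the number of remaining Walker moves: a move along a new edge adds 1 to
-- length ps but 2 to 2 * visitedSize s, and a backtracking move subtracts 1 from length ps.
mutual
  walker-to-move : ∀ f {s : State (2 + n)} {ps} → Exploring 0 s ps →
    2 * 2 ^ n + length ps ≤ 2 * visitedSize s + f → WalkerForcesW (2 ^ n) s
  walker-to-move {n} f {s} {ps} ex fuel with <-≤-connex (visitedSize s) (2 ^ n)
  ... | inj₂ large = reachedW (≤-trans large (visitedSize≤count s))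
  ... | inj₁ small with f
  ...   | zero = contradiction (≤-trans (m≤m+n _ _) (subst (2 * 2 ^ n + length ps ≤_) (+-identityʳ _) fuel))
                   (<⇒≱ (*-monoʳ-< 2 small))
  ...   | suc f with Fin.any? (escape? s (pos s))
  ...     | yes (i , esc) = moveW (exploring⇒¬Over ex small) i (proj₂ esc)
              (breaker-to-move f (push ex esc) (begin
                2 * 2 ^ n + suc (length ps)          ≡⟨ +-suc _ _ ⟩
                suc (2 * 2 ^ n + length ps)          ≤⟨ s≤s fuel ⟩
                suc (2 * visitedSize s + suc f)      ≡⟨ rearrange (visitedSize s) f ⟩
                2 * suc (visitedSize s) + f
                  ≤⟨ +-monoˡ-≤ f (*-monoʳ-≤ 2 {suc (visitedSize s)} (size-∷-∉ _ (visited s) (proj₁ esc))) ⟩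
                2 * visitedSize (walkerMove s i) + f ∎))
    where
    open ≤-Reasoning
    rearrange : ∀ m f → suc (2 * m + suc f) ≡ 2 * suc m + f
    rearrange = solve-∀
  ...     | no stuck with trail ex | escape ex small
  -- With an empty stack, the escape could only start at Walker's position.
  ...       | root | _ , i , here refl , esc = contradiction (i , esc) stuck
  ...       | back {q = q} {ps = qs} i q≡ e∈W t | _ = moveW (exploring⇒¬Over ex small) i (disjoint ex _ e∈W)
              (breaker-to-move f (pop ex stuck q≡ e∈W t) (s≤s⁻¹ (begin
                suc (2 * 2 ^ n + length qs)              ≡⟨ sym (+-suc _ _) ⟩
                2 * 2 ^ n + suc (length qs)              ≤⟨ fuel ⟩
                2 * visitedSize s + suc f
                  ≤⟨ +-monoˡ-≤ (suc f) (*-monoʳ-≤ 2 (size-∷ _ (visited s))) ⟩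
                2 * visitedSize (walkerMove s i) + suc f ≡⟨ +-suc _ f ⟩
                suc (2 * visitedSize (walkerMove s i) + f) ∎)))
    where open ≤-Reasoning

  breaker-to-move : ∀ f {s : State (2 + n)} {ps} → Exploring 1 s ps →
    2 * 2 ^ n + length ps ≤ 2 * visitedSize s + f → WalkerForcesB (2 ^ n) s
  breaker-to-move {n} f {s} ex fuel with <-≤-connex (visitedSize s) (2 ^ n)
  ... | inj₂ large = reachedB (≤-trans large (visitedSize≤count s))
  ... | inj₁ small = allB (exploring⇒¬Over ex small)
    λ e legal → walker-to-move f (reply ex legal) fuel

walker-forces : (v : Vertex (2 + n)) → WalkerForcesW (2 ^ n) (initial v)
walker-forces {n} v = walker-to-move (2 * 2 ^ n) (record
  { trail     = root
  ; exhausted = λ _ _ x∈ _ _ → x∈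
  ; disjoint  = λ _ _ ()
  ; few       = *-monoʳ-≤ 2 {1} (≤-<-trans z≤n (size-∷-∉ v [] λ ()))
  }) (subst (_≤ 2 * visitedSize (initial v) + 2 * 2 ^ n) (sym (+-identityʳ _))
  (m≤n+m (2 * 2 ^ n) (2 * visitedSize (initial v))))

-- Deciding whether the game is over

vertices : ∀ n → List (Vertex n)
vertices zero    = [] ∷ []
vertices (suc n) = map (false ∷_) (vertices n) ++ map (true ∷_) (vertices n)

∈-vertices : (v : Vertex n) → v ∈ vertices n
∈-vertices []          = here refl
∈-vertices (false ∷ v) = ∈-++⁺ˡ (∈-map⁺ (false ∷_) (∈-vertices v))
∈-vertices (true ∷ v)  = ∈-++⁺ʳ _ (∈-map⁺ (true ∷_) (∈-vertices v))

edges : ∀ n → List (Edge n)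
edges n = cartesianProduct (vertices n) (allFin n)

∈-edges : (e : Edge n) → e ∈ edges n
∈-edges (v , i) = ∈-cartesianProduct⁺ (∈-vertices v) (∈-allFin i)

module _ {A : Set} (_≟_ : (x y : A) → Dec (x ≡ y)) where

  delete : A → List A → List A
  delete x = filter (λ y → ¬? (x ≟ y))

  length-delete : ∀ {x L} → x ∈ L → length (delete x L) < length L
  length-delete {x} {L} x∈L = filter-notAll (λ y → ¬? (x ≟ y)) L (Any.map (λ x≡y x≢y → x≢y x≡y) x∈L)

  ∈-delete : ∀ {x y L} → y ∈ L → x ≢ y → y ∈ delete x L
  ∈-delete {x} = ∈-filter⁺ (λ y → ¬? (x ≟ y))

ReachableSet : List (Edge n) → Vertex n → Set
ReachableSet B p = ∃ λ R → (∀ x → x ∈ R → Reach B p x) × (∀ x → Reach B p x → x ∈ R)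

-- R grows to a set closed under free edges; U contains the vertices outside R.
saturate : ∀ (B : List (Edge n)) p f (R U : List (Vertex n)) → p ∈ R →
  (∀ x → x ∈ R → Reach B p x) → (∀ x → x ∈ R ⊎ x ∈ U) → length U ≤ f → ReachableSet B p
saturate {n} B p f R U p∈R sound cover len with any? (λ x → Fin.any? (extends? x)) U
  where
  extends? : ∀ x i → Dec (flipAt i x ∈ R × (x , i) ∉E B)
  extends? x i = (flipAt i x ∈? R) ×-dec ¬? ((x , i) ∈E? B)
... | no none = R , sound , λ x → closed p∈R
  where
  closed : ∀ {x y} → x ∈ R → Reach B x y → y ∈ R
  closed x∈R here = x∈R
  closed {x} x∈R (step i free r) with cover (flipAt i x)
  ... | inj₁ fx∈R = closed fx∈R r
  ... | inj₂ fx∈U = contradiction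
    (lose fx∈U (i , subst (_∈ R) (sym (flipAt-involutive i x)) x∈R ,
      free ∘ ∈E-resp (sameEdge-sym (sameEdge-flip i x)))) none
... | yes found with find found | f
...   | x , x∈U , _ | zero = contradiction (≤-trans (length-delete _≟ⱽ_ x∈U) len) λ ()
...   | x , x∈U , i , fx∈R , free | suc f =
  saturate B p f (x ∷ R) (delete _≟ⱽ_ x U) (there p∈R)
    (λ where
      y (here refl)  → subst (Reach B p) (flipAt-involutive i x)
        (reach-snoc i (free ∘ ∈E-resp (sameEdge-sym (sameEdge-flip i x))) (sound _ fx∈R))
      y (there y∈R) → sound y y∈R)
    cover′
    (s≤s⁻¹ (≤-trans (length-delete _≟ⱽ_ x∈U) len))
  where
  cover′ : ∀ y → y ∈ x ∷ R ⊎ y ∈ delete _≟ⱽ_ x U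
  cover′ y with x ≟ⱽ y | cover y
  ... | yes refl | _        = inj₁ (here refl)
  ... | no _     | inj₁ y∈R = inj₁ (there y∈R)
  ... | no x≢y   | inj₂ y∈U = inj₂ (∈-delete _≟ⱽ_ y∈U x≢y)

reachableSet : (B : List (Edge n)) (p : Vertex n) → ReachableSet B p
reachableSet {n} B p = saturate B p _ (p ∷ []) (vertices n) (here refl)
  (λ where _ (here refl) → here) (λ x → inj₂ (∈-vertices x)) ≤-refl

NotOver : State n → Set
NotOver s = ∃ λ w → Reach (breakerE s) (pos s) w × w ∉ visited s

-- Breaker's strategy has to choose between ending and continuing the game; computing the finite set
-- of reachable vertices makes the choice constructive.
notOver? : (s : State n) → Dec (NotOver s)
notOver? s with (R , sound , complete) ← reachableSet (breakerE s) (pos s) =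
  map′ (λ found → let (w , w∈R , w∉) = find found in w , sound w w∈R , w∉)
       (λ (w , r , w∉) → lose (complete w r) w∉)
       (any? (λ w → ¬? (w ∈? visited s)) R)

frontier : ∀ (B : List (Edge n)) {p w} L → p ∈ L → w ∉ L → Reach B p w →
  ∃₂ λ x i → flipAt i x ∉ L × (x , i) ∉E B
frontier B L p∈ w∉ here = contradiction p∈ w∉
frontier B {p} L p∈ w∉ (step i free r) with flipAt i p ∈? L
... | yes fp∈ = frontier B L fp∈ w∉ r
... | no fp∉  = p , i , fp∉ , free

-- Breaker's confinement of Walker to a half-cube

halfCube? : (d : Fin n) (b : Bool) → Decidable (λ v → lookup v d ≡ b)
halfCube? d b v = lookup v d Bool.≟ b

size-halfCube : (d : Fin (suc n)) (b : Bool) → size (halfCube? d b) ≤ 2 ^ n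
size-halfCube {n} zero false = subst₂ _≤_ refl (+-identityʳ _)
  (+-mono-≤ (size≤2^n {n} (λ v → halfCube? zero false (false ∷ v)))
    (≤-reflexive (size-∅ {n} (λ v → halfCube? zero false (true ∷ v)) λ _ ())))
size-halfCube {n} zero true = +-mono-≤
    (≤-reflexive (size-∅ {n} (λ v → halfCube? zero true (false ∷ v)) λ _ ()))
    (size≤2^n {n} (λ v → halfCube? zero true (true ∷ v)))
size-halfCube {suc n} (suc d) b = +-mono-≤ (size-halfCube d b)
  (subst (size (halfCube? d b) ≤_) (sym (+-identityʳ _)) (size-halfCube d b))

-- `walked` makes Breaker's replies legal: Walker owns neither an edge in direction `d` nor an edge
-- leaving the visited set.
record Confined (d : Fin n) (b : Bool) (s : State n) : Set where
  field
    visited-half : ∀ x → x ∈ visited s → lookup x d ≡ b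
    pos-visited  : pos s ∈ visited s
    walked       : ∀ x i → (x , i) ∈E walkerE s → i ≢ d × flipAt i x ∈ visited s
open Confined

confined⇒count≤ : ∀ {d b} {s : State (suc n)} → Confined d b s → count s ≤ 2 ^ n
confined⇒count≤ {d = d} {b} {s} c = ≤-trans (count≤visitedSize s) (≤-trans
  (size-mono (_∈? visited s) (halfCube? d b) (visited-half c)) (size-halfCube d b))

confined-walkerMove : ∀ {d b i} {s : State n} → i ≢ d → Confined d b s → Confined d b (walkerMove s i)
confined-walkerMove {d = d} {i = i} {s} i≢d c = record
  { visited-half = λ where
      x (here refl) → trans (Vec.lookup∘updateAt′ d i (i≢d ∘ sym) (pos s)) (visited-half c _ (pos-visited c))
      x (there x∈)  → visited-half c x x∈
  ; pos-visited = here refl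
  ; walked = λ where
      x j (here (refl , inj₁ refl)) → i≢d , here refl
      x j (here (refl , inj₂ refl)) → i≢d , there (pos-visited c)
      x j (there e∈) → map₂ there (walked c x j e∈)
  }

confined-breakerMove : ∀ {d b e} {s : State n} → Confined d b s → Confined d b (breakerMove s e)
confined-breakerMove c = record
  { visited-half = visited-half c ; pos-visited = pos-visited c ; walked = walked c }

-- Breaker's target is the edge in direction d at Walker's position; if he owns it
-- already, an edge leading out of the visited set serves as a harmless waiting move.
breaker-choice : ∀ {d b} {s : State n} → Confined d b s → NotOver s →
  ∃ λ e → BreakerLegal s e × (pos s , d) ∈E (e ∷ breakerE s)
breaker-choice {d = d} {s = s} c (w , r , w∉) with (pos s , d) ∈E? breakerE s
... | no free = (pos s , d) , ((λ e∈W → proj₁ (walked c _ d e∈W) refl) , free) , here (refl , inj₁ refl)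
... | yes held with (x , i , fx∉ , free) ← frontier (breakerE s) (visited s) (pos-visited c) w∉ r =
  (x , i) , (fx∉ ∘ proj₂ ∘ walked c x i , free) , there held

_≟ᴱ_ : (e f : Edge n) → Dec (e ≡ f)
_≟ᴱ_ = Product.≡-dec _≟ⱽ_ Fin._≟_

-- F contains every edge not yet taken by Breaker, so that its length bounds his remaining moves.
mutual
  confined-to-move : ∀ {d b} f {s : State (suc n)} F → Confined d b s → (pos s , d) ∈E breakerE s →
    (∀ e → e ∉E breakerE s → e ∈ F) → length F ≤ f → BreakerForcesW (2 ^ n) s
  confined-to-move f {s} F c guarded cover len with notOver? s
  ... | no over  = endW over (confined⇒count≤ c)
  ... | yes open′ = allW (λ over → over open′) λ i legal →
    -- A step in direction `d` would use the edge that Breaker holds.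
    confining-to-move f F (confined-walkerMove (λ where refl → legal guarded) c) cover len

  confining-to-move : ∀ {d b} f {s : State (suc n)} F → Confined d b s →
    (∀ e → e ∉E breakerE s → e ∈ F) → length F ≤ f → BreakerForcesB (2 ^ n) s
  confining-to-move f {s} F c cover len with notOver? s
  ... | no over  = endB over (confined⇒count≤ c)
  ... | yes open′ with breaker-choice c open′ | f
  ...   | e , (_ , e∉B) , _ | zero =
    contradiction (≤-trans (length-delete _≟ᴱ_ (cover e e∉B)) len) λ ()
  ...   | e , legal@(_ , e∉B) , guarded | suc f = moveB (λ over → over open′) e legal
    (confined-to-move f (delete _≟ᴱ_ e F) (confined-breakerMove c) guarded
      (λ e′ e′∉ → ∈-delete _≟ᴱ_ (cover e′ (e′∉ ∘ there)) λ where refl → e′∉ (here (refl , inj₁ refl)))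
      (s≤s⁻¹ (≤-trans (length-delete _≟ᴱ_ (cover e e∉B)) len)))

another-direction : (i : Fin (2 + n)) → ∃ λ d → i ≢ d
another-direction zero    = suc zero , λ ()
another-direction (suc i) = zero , λ ()

confined-initial : (d : Fin n) (v : Vertex n) → Confined d (lookup v d) (initial v)
confined-initial d v = record
  { visited-half = λ where _ (here refl) → refl
  ; pos-visited  = here refl
  ; walked       = λ _ _ ()
  }

breaker-forces : (v : Vertex (2 + n)) → BreakerForcesW (2 ^ suc n) (initial v)
breaker-forces {n} v with notOver? (initial v)
... | no over  = endW over (confined⇒count≤ (confined-initial zero v))
-- Walker moves before Breaker guards anything, so `d` is fixed only once her first direction is
-- known.
... | yes open′ = allW (λ over → over open′) λ i _ → let (d , i≢d) = another-direction i in
  confining-to-move _ (edges (2 + n)) (confined-walkerMove i≢d (confined-initial d v)) (λ e _ → ∈-edges e) ≤-refl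

theorem4 : (n : ℕ) → 2 ≤ n → (v : Vertex n) →
    WalkerForcesW (2 ^ (n ∸ 2)) (initial v) × BreakerForcesW (2 ^ (n ∸ 1)) (initial v)
theorem4 (suc zero)    (s≤s ()) _
theorem4 (suc (suc n)) _ v = walker-forces v , breaker-forces v
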